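{- Each of the following families of games is domestic but not tame, and returnable but not forced: Knight on the set of all nonempty subpartitions of generalized staircases; Knight on the set of all nonempty partitions.
   Context: A partition is a finite weakly decreasing sequence $\lambda=[\lambda_1,\ldots,\lambda_r]$ of positive integers; $[\,]$ is the empty partition, and $\mathbb Y^+$ is the set of nonempty partitions. For $i,j\ge 0$, $\lambda[i,j]=[\lambda_{i+1}-j,\lambda_{i+2}-j,\ldots]$ with trailing nonpositive entries removed. For a moveset $M\subseteq \mathbb Z_{\ge0}^2\setminus\{(0,0)\}$ and $\lambda\in\mathbb Y^+$, the impartial chess game $(M,\lambda)$ starts at $\lambda$, and from a position $\mu\in\mathbb Y^+$ a player may move to $\mu[i,j]$ for any $(i,j)\in M$ with $\mu[i,j]\ne[\,]$. The positions of $(M,\lambda)$ are the partitions reachable from $\lambda$ by zero or more moves. A position is terminal if it has no moves. Knight has moveset $\{(1,2),(2,1)\}$. The generalized staircase with parameters $r,c,k\ge1$ is $[(kc)^r,((k-1)c)^r,\ldots,c^r]$ (exponents denote repetition). A nonempty subpartition of a generalized staircase $\lambda$ is a partition $\lambda[i,j]\neq[\,]$ with $i,j\ge0$. The Sprague-Grundy value of a position $p$ is $\mathrm{mex}$ of the Sprague-Grundy values of the positions reachable in one move ($0$ if $p$ is terminal), where $\mathrm{mex}(S)$ is the least nonnegative integer not in $S$. The misère Grundy value is defined by the same mex recursion at non-terminal positions, but terminal positions have value $1$. A position with Sprague-Grundy value $t$ and misère Grundy value $\ell$ is called a $(t,\ell)$-position. A game is returnable if for any move from a $(0,1)$-position (resp.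 a $(1,0)$-position) to a non-terminal position $y$, there is a move from $y$ to a $(0,1)$-position (resp. to a $(1,0)$-position). A game is forced if each move from a $(0,1)$-position results in a $(1,0)$-position and each move from a $(1,0)$-position results in a $(0,1)$-position. A game is domestic if it has neither $(0,k)$-positions nor $(k,0)$-positions with $k\ge2$. A game is tame if it has only $(0,1)$-positions, $(1,0)$-positions, and $(k,k)$-positions with $k\ge0$. For a moveset $M$ and a set $P\subseteq\mathbb Y^+$, the family $(M,P)$ has one of these properties if $(M,\lambda)$ has it for every $\lambda\in P$, and it does not have the property if $(M,\lambda)$ fails it for at least one $\lambda\in P$. -}

module Defs where

open import Data.List.Base using (List; []; _∷_; _++_; drop; filter; map; replicate)
open import Data.List.Membership.DecPropositional using () renaming (_∈?_ to mk-∈?)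
open import Data.List.Membership.Propositional using (_∈_; _∉_; mapWith∈)
open import Data.List.Membership.Propositional.Properties using (∈-filter⁻; ∈-map⁻; mapWith∈-cong; mapWith∈≗map)
open import Data.List.Relation.Unary.All as All using (All; []; _∷_)
import Data.List.Relation.Unary.All.Properties as All
open import Data.List.Relation.Unary.AllPairs as AllPairs using (AllPairs; []; _∷_)
import Data.List.Relation.Unary.AllPairs.Properties as AllPairs
open import Data.List.Relation.Unary.Any using (here; there)
open import Data.List.Relation.Unary.Linked as Linked using (Linked; []; [-]; _∷_)
import Data.List.Relation.Unary.Linked.Properties as Linked
open import Data.Nat.Base using (ℕ; zero; suc; _+_; _*_; _∸_; _≤_; _<_; _≥_; z≤n; s≤s; NonZero)
open import Data.Nat.ListAction using (sum)
open import Data.Nat.Induction using (<-wellFounded)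
open import Data.Nat.Properties
open import Data.Product.Base using (∃; _×_; _,_; proj₁; proj₂)
open import Data.Sum.Base using (_⊎_; inj₁; inj₂)
open import Function.Base using (_∘_)
open import Induction.WellFounded using (Acc; acc)
open import Level using (0ℓ)
open import Relation.Binary.Construct.Closure.ReflexiveTransitive using (Star)
open import Relation.Binary.PropositionalEquality using (_≡_; _≢_; refl; sym; trans; cong; subst)
open import Relation.Nullary using (¬_; Dec; yes; no; contradiction; does)
open import Relation.Nullary.Decidable using (¬?)
open import Relation.Unary using (Pred)
open import Data.Bool.Base using (true; false)

record Partition : Set where
  constructor partition
  field
    parts      : List ℕ
    decreasing : Linked _≥_ parts
    positive   : All (0 <_) parts

open Partition public

Nonempty : Pred Partition 0ℓ
Nonempty μ = parts μ ≢ []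

nonempty? : ∀ μ → Dec (Nonempty μ)
nonempty? (partition []      _ _) = no λ ne → ne refl
nonempty? (partition (_ ∷ _) _ _) = yes λ ()

-- Truncated subtraction sends the nonpositive entries of λ - j to 0; as the
-- sequence is weakly decreasing they are trailing, and filter removes them.

shift : ℕ → ℕ → List ℕ → List ℕ
shift i j xs = filter (0 <?_) (map (_∸ j) (drop i xs))

private
  drop-linked : ∀ i {xs} → Linked _≥_ xs → Linked _≥_ (drop i xs)
  drop-linked zero    l       = l
  drop-linked (suc i) []      = []
  drop-linked (suc i) [-]     = drop-linked i []
  drop-linked (suc i) (_ ∷ l) = drop-linked i l

infix 30 _[_,_]

_[_,_] : Partition → ℕ → ℕ → Partition
parts      (μ [ i , j ]) = shift i j (parts μ)
decreasing (μ [ i , j ]) =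
  Linked.filter⁺ (0 <?_) (λ x≥y y≥z → ≤-trans y≥z x≥y)
    (Linked.map⁺ (Linked.map (∸-monoˡ-≤ j) (drop-linked i (decreasing μ))))
positive   (μ [ i , j ]) = All.all-filter (0 <?_) (map (_∸ j) (drop i (parts μ)))

-- [(kc)^r, ((k-1)c)^r, …, c^r]

staircaseParts : (r c k : ℕ) → List ℕ
staircaseParts r c zero      = []
staircaseParts r c k@(suc h) = replicate r (k * c) ++ staircaseParts r c h

private
  staircase-≤ : ∀ r c k → All (_≤ k * c) (staircaseParts r c k)
  staircase-≤ r c zero    = []
  staircase-≤ r c (suc h) = All.++⁺ (All.replicate⁺ r ≤-refl)
    (All.map (λ x≤ → ≤-trans x≤ (m≤n+m (h * c) c)) (staircase-≤ r c h))

  replicate-pairs : ∀ r x → AllPairs _≥_ (replicate r x)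
  replicate-pairs zero    x = []
  replicate-pairs (suc r) x = All.replicate⁺ r ≤-refl ∷ replicate-pairs r x

  staircase-pairs : ∀ r c k → AllPairs _≥_ (staircaseParts r c k)
  staircase-pairs r c zero    = []
  staircase-pairs r c (suc h) = AllPairs.++⁺ (replicate-pairs r _) (staircase-pairs r c h)
    (All.replicate⁺ r (All.map (λ x≤ → ≤-trans x≤ (m≤n+m (h * c) c)) (staircase-≤ r c h)))

  staircase-positive : ∀ r c k → 0 < c → All (0 <_) (staircaseParts r c k)
  staircase-positive r c zero    0<c = []
  staircase-positive r c (suc h) 0<c =
    All.++⁺ (All.replicate⁺ r (≤-trans 0<c (m≤m+n c (h * c)))) (staircase-positive r c h 0<c)

staircase : (r c k : ℕ) → 1 ≤ c → Partition
parts      (staircase r c k 1≤c) = staircaseParts r c k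
decreasing (staircase r c k 1≤c) = Linked.AllPairs⇒Linked (staircase-pairs r c k)
positive   (staircase r c k 1≤c) = staircase-positive r c k 1≤c

data GeneralizedStaircase : Pred Partition 0ℓ where
  gs : ∀ {r c k} → 1 ≤ r → (1≤c : 1 ≤ c) → 1 ≤ k →
       GeneralizedStaircase (staircase r c k 1≤c)

NonemptySubpartitionOf : Pred Partition 0ℓ → Pred Partition 0ℓ
NonemptySubpartitionOf P μ =
  ∃ λ σ → P σ × ∃ λ i → ∃ λ j → μ ≡ σ [ i , j ] × Nonempty μ

-- Movesets are finite here, so that options and values are computable.

record Moveset : Set where
  field
    moves      : List (ℕ × ℕ)
    nontrivial : (0 , 0) ∉ moves

open Moveset public

Knight : Moveset
moves      Knight = (1 , 2) ∷ (2 , 1) ∷ []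
nontrivial Knight (there (here ()))
nontrivial Knight (there (there ()))

options : Moveset → Partition → List Partition
options M μ = filter nonempty? (map (λ (i , j) → μ [ i , j ]) (moves M))

-- mex S is the least n ∉ S, found by trying 0, 1, 2, …; 1 + sum S is an upper
-- bound for it.  That the result is the least such n is mex-∉ and mex-least.

private
  _∈?_ : (n : ℕ) (S : List ℕ) → Dec (n ∈ S)
  _∈?_ = mk-∈? _≟_

search : (fuel n : ℕ) → List ℕ → ℕ
search zero       n S = n
search (suc fuel) n S with n ∈? S
... | yes _ = search fuel (suc n) S
... | no  _ = n

mex : List ℕ → ℕ
mex S = search (suc (sum S)) 0 S

private
  ∈⇒≤sum : ∀ {n S} → n ∈ S → n ≤ sum S
  ∈⇒≤sum {S = x ∷ S} (here refl) = m≤m+n x (sum S)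
  ∈⇒≤sum {S = x ∷ S} (there n∈)  = ≤-trans (∈⇒≤sum n∈) (m≤n+m (sum S) x)

  search-∉ : ∀ fuel n S → n + fuel ∉ S → search fuel n S ∉ S
  search-∉ zero       n S b = b ∘ subst (_∈ S) (sym (+-identityʳ n))
  search-∉ (suc fuel) n S b with n ∈? S
  ... | yes _  = search-∉ fuel (suc n) S (b ∘ subst (_∈ S) (sym (+-suc n fuel)))
  ... | no  n∉ = n∉

  search-least : ∀ fuel n S → (∀ {m} → m < n → m ∈ S) →
                 ∀ {m} → m < search fuel n S → m ∈ S
  search-least zero       n S b = b
  search-least (suc fuel) n S b with n ∈? S
  ... | no  _  = b
  ... | yes n∈ = search-least fuel (suc n) S b′
    where
    b′ : ∀ {m} → m < suc n → m ∈ S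
    b′ (s≤s m≤n) with m≤n⇒m<n∨m≡n m≤n
    ... | inj₁ m<n  = b m<n
    ... | inj₂ refl = n∈

mex-∉ : ∀ S → mex S ∉ S
mex-∉ S = search-∉ (suc (sum S)) 0 S (λ b → <-irrefl refl (∈⇒≤sum b))

mex-least : ∀ S {m} → m < mex S → m ∈ S
mex-least S = search-least (suc (sum S)) 0 S λ ()

-- Every move decreases the sum of the parts.

size : Partition → ℕ
size = sum ∘ parts

private
  sum-filter : ∀ xs → sum (filter (0 <?_) xs) ≤ sum xs
  sum-filter []       = z≤n
  sum-filter (x ∷ xs) with does (0 <? x)
  ... | true  = +-monoʳ-≤ x (sum-filter xs)
  ... | false = ≤-trans (sum-filter xs) (m≤n+m (sum xs) x)

  sum-map : ∀ j xs → sum (map (_∸ j) xs) ≤ sum xs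
  sum-map j []       = z≤n
  sum-map j (x ∷ xs) = +-mono-≤ (m∸n≤m x j) (sum-map j xs)

  sum-drop : ∀ i xs → sum (drop i xs) ≤ sum xs
  sum-drop zero    xs       = ≤-refl
  sum-drop (suc i) []       = z≤n
  sum-drop (suc i) (x ∷ xs) = ≤-trans (sum-drop i xs) (m≤n+m (sum xs) x)

  sum-shift : ∀ i j xs → sum (shift i j xs) ≤ sum xs
  sum-shift i j xs = ≤-trans (sum-filter (map (_∸ j) (drop i xs)))
    (≤-trans (sum-map j (drop i xs)) (sum-drop i xs))

  shift-< : ∀ i j xs → All (0 <_) xs → (i , j) ≢ (0 , 0) → shift i j xs ≢ [] →
            sum (shift i j xs) < sum xs
  shift-< zero    zero    _  _ ij≢0 _  = contradiction refl ij≢0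
  shift-< zero    (suc j) [] _ _    ne = contradiction refl ne
  shift-< (suc i) j       [] _ _    ne = contradiction refl ne
  shift-< zero    (suc j) (zero ∷ xs)  (() ∷ _)
  shift-< zero    (suc j) (suc x ∷ xs) _ _ _ =
    ≤-<-trans (sum-filter (map (_∸ suc j) (suc x ∷ xs)))
              (+-mono-<-≤ (s≤s (m∸n≤m x j)) (sum-map (suc j) xs))
  shift-< (suc i) j       (x ∷ xs) (0<x ∷ _) _ _ =
    ≤-<-trans (sum-shift i j xs) (m<n+m (sum xs) 0<x)

options-< : ∀ M μ {ν} → ν ∈ options M μ → size ν < size μ
options-< M μ ν∈ with ∈-filter⁻ nonempty? {xs = map (λ (i , j) → μ [ i , j ]) (moves M)} ν∈
... | ν∈′ , ne with ∈-map⁻ (λ (i , j) → μ [ i , j ]) ν∈′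
... | (i , j) , ij∈ , refl =
  shift-< i j (parts μ) (positive μ) (λ { refl → nontrivial M ij∈ }) ne

-- t is the value of terminal positions: 0 for Sprague-Grundy, 1 for misère.

combine : ℕ → List ℕ → ℕ
combine t []         = t
combine t vs@(_ ∷ _) = mex vs

valueAcc : ∀ t M μ → Acc _<_ (size μ) → ℕ
valueAcc t M μ (acc rs) =
  combine t (mapWith∈ (options M μ) λ {ν} ν∈ → valueAcc t M ν (rs (options-< M μ ν∈)))

value : ℕ → Moveset → Partition → ℕ
value t M μ = valueAcc t M μ (<-wellFounded (size μ))

private
  valueAcc-irr : ∀ t M μ (a b : Acc _<_ (size μ)) → valueAcc t M μ a ≡ valueAcc t M μ b
  valueAcc-irr t M μ (acc rs) (acc rs′) = cong (combine t)
    (mapWith∈-cong (options M μ) _ _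
      λ {ν} ν∈ → valueAcc-irr t M ν (rs (options-< M μ ν∈)) (rs′ (options-< M μ ν∈)))

  valueAcc-unfold : ∀ t M μ (a : Acc _<_ (size μ)) →
                    valueAcc t M μ a ≡ combine t (map (value t M) (options M μ))
  valueAcc-unfold t M μ (acc rs) = cong (combine t)
    (trans (mapWith∈-cong (options M μ) _ (λ {ν} _ → value t M ν)
              λ {ν} ν∈ → valueAcc-irr t M ν (rs (options-< M μ ν∈)) (<-wellFounded (size ν)))
           (mapWith∈≗map (value t M) (options M μ)))

value-unfold : ∀ t M μ → value t M μ ≡ combine t (map (value t M) (options M μ))
value-unfold t M μ = valueAcc-unfold t M μ (<-wellFounded (size μ))

spragueGrundy misère : Moveset → Partition → ℕ
spragueGrundy = value 0
misère        = value 1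

module _ (M : Moveset) where

  infix 4 _⟶_ _⟶*_

  _⟶_ : Partition → Partition → Set
  μ ⟶ ν = ν ∈ options M μ

  _⟶*_ : Partition → Partition → Set
  _⟶*_ = Star _⟶_

  Terminal : Pred Partition 0ℓ
  Terminal μ = ∀ ν → ¬ (μ ⟶ ν)

  _,_-position : ℕ → ℕ → Pred Partition 0ℓ
  (t , ℓ -position) μ = spragueGrundy M μ ≡ t × misère M μ ≡ ℓ

  Domestic : Pred Partition 0ℓ
  Domestic λ₀ = ∀ {x} → λ₀ ⟶* x → ∀ k → 2 ≤ k →
    ¬ (0 , k -position) x × ¬ (k , 0 -position) x

  Tame : Pred Partition 0ℓ
  Tame λ₀ = ∀ {x} → λ₀ ⟶* x →
    (0 , 1 -position) x ⊎ (1 , 0 -position) x ⊎ ∃ λ k → (k , k -position) x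

  Returnable : Pred Partition 0ℓ
  Returnable λ₀ = ∀ {x y} → λ₀ ⟶* x → x ⟶ y → ¬ Terminal y →
    ((0 , 1 -position) x → ∃ λ z → y ⟶ z × (0 , 1 -position) z) ×
    ((1 , 0 -position) x → ∃ λ z → y ⟶ z × (1 , 0 -position) z)

  Forced : Pred Partition 0ℓ
  Forced λ₀ = ∀ {x y} → λ₀ ⟶* x → x ⟶ y →
    ((0 , 1 -position) x → (1 , 0 -position) y) ×
    ((1 , 0 -position) x → (0 , 1 -position) y)

Has Lacks : (Moveset → Pred Partition 0ℓ) → Moveset → Pred Partition 0ℓ → Set
Has   Q M P = ∀ λ₀ → P λ₀ → Q M λ₀
Lacks Q M P = ∃ λ λ₀ → P λ₀ × ¬ Q M λ₀

{-# OPTIONS --safe #-}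

-- Give a partition the state (t , ℓ) of its values, or none if it is empty.  The
-- two options of μ are ν [ 0 , 1 ] and ν [ 1 , 0 ] for ν = μ [ 1 , 1 ], so consider
-- the pair of their states for an arbitrary ν.  If both are nonempty, the pair is
-- determined by the states of ν [ 1 , 3 ], ν [ 2 , 2 ] and ν [ 3 , 1 ], whose
-- consecutive pairs belong likewise to ν [ 1 , 2 ] and ν [ 2 , 1 ].  If one of them is
-- empty, so are these three, and the other is empty or terminal.  Hence only the
-- pairs in a finite set closed under this step can occur, and domesticity and
-- returnability are checked on that set.

module Submission where

open import Defs
open import Data.List.Base using (List; []; _∷_; catMaybes; concatMap; drop; filter; map)
open import Data.List.Membership.Propositional using (_∈_)
open import Data.List.Membership.Propositional.Properties using (∈-filter⁺; ∈-filter⁻; ∈-map⁺; ∈-map⁻)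
open import Data.List.Properties using (drop-drop; drop-map; filter-none; map-∘; map-cong)
open import Data.List.Relation.Unary.All as All using (All; []; _∷_)
import Data.List.Relation.Unary.All.Properties as All
open import Data.List.Relation.Unary.AllPairs as AllPairs using (AllPairs; []; _∷_)
import Data.List.Relation.Unary.AllPairs.Properties as AllPairs
open import Data.List.Relation.Unary.Any using (here; there)
open import Data.List.Relation.Unary.Linked as Linked using (Linked)
import Data.List.Relation.Unary.Linked.Properties as Linked
open import Data.Maybe.Base using (Maybe; just; nothing)
open import Data.Maybe.Properties using (just-injective)
import Data.Maybe.Properties as Maybe
open import Data.Nat.Base using (ℕ; zero; suc; _+_; _∸_; _≤_; _<_; _≥_; z≤n; s≤s)
open import Data.Nat.Induction using (<-wellFounded)
open import Data.Nat.Properties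
open import Data.Product.Base using (∃; _×_; _,_; proj₁; proj₂)
import Data.Product.Properties as Product
open import Data.Sum.Base using (inj₁; inj₂)
open import Function.Base using (_∘_)
open import Induction.WellFounded using (Acc; acc)
open import Relation.Binary.Construct.Closure.ReflexiveTransitive using (ε)
open import Relation.Binary.Definitions using (DecidableEquality)
open import Relation.Binary.PropositionalEquality using (_≡_; _≢_; refl; sym; trans; cong; cong₂; subst; subst₂; module ≡-Reasoning)
open import Relation.Nullary using (¬_; Dec; yes; no; contradiction)
open import Relation.Nullary.Decidable using (_×-dec_; _→-dec_; ¬?; from-yes)

-- Composition of shifts.

parts-injective : ∀ {μ ν} → parts μ ≡ parts ν → μ ≡ ν
parts-injective {partition _ d p} {partition _ d′ p′} refl =
  cong₂ (partition _) (Linked.irrelevant ≤-irrelevant d d′) (All.irrelevant ≤-irrelevant p p′)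

-- In a weakly decreasing list the zeros form a suffix. Once a zero is met, everything after it is
-- zero and both sides are empty.
drop-filter-pos : ∀ i {xs} → AllPairs _≥_ xs → drop i (filter (0 <?_) xs) ≡ filter (0 <?_) (drop i xs)
drop-filter-pos zero    _  = refl
drop-filter-pos (suc i) [] = refl
drop-filter-pos (suc i) {suc x ∷ xs} (_ ∷ ps)   = drop-filter-pos i ps
drop-filter-pos (suc i) {zero  ∷ xs} (x≥ ∷ _) = trans
  (cong (drop (suc i)) (filter-none (0 <?_) zeros))
  (sym (filter-none (0 <?_) (All.drop⁺ i zeros)))
  where
  zeros : All (λ x → ¬ 0 < x) xs
  zeros = All.map ≤⇒≯ x≥

-- The entries removed by the inner filter are zeros, which truncated subtraction keeps at zero, so
-- the outer filter removes them as well.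
filter-map-∸ : ∀ j xs → filter (0 <?_) (map (_∸ j) (filter (0 <?_) xs)) ≡ filter (0 <?_) (map (_∸ j) xs)
filter-map-∸ j []           = refl
filter-map-∸ j (zero ∷ xs) rewrite 0∸n≡0 j = filter-map-∸ j xs
filter-map-∸ j (suc x ∷ xs) with suc x ∸ j
... | suc y = cong (suc y ∷_) (filter-map-∸ j xs)
... | zero  = filter-map-∸ j xs

shift-shift : ∀ i j k l {xs} → AllPairs _≥_ xs → shift k l (shift i j xs) ≡ shift (i + k) (j + l) xs
shift-shift i j k l {xs} ps = begin
  pos (map (_∸ l) (drop k (pos (map (_∸ j) (drop i xs)))))
    ≡⟨ cong (pos ∘ map (_∸ l)) (drop-filter-pos k (AllPairs.map⁺ (pairs (AllPairs.drop⁺ i ps)))) ⟩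
  pos (map (_∸ l) (pos (drop k (map (_∸ j) (drop i xs)))))
    ≡⟨ filter-map-∸ l (drop k (map (_∸ j) (drop i xs))) ⟩
  pos (map (_∸ l) (drop k (map (_∸ j) (drop i xs))))
    ≡⟨ cong (pos ∘ map (_∸ l)) (drop-map k (drop i xs)) ⟩
  pos (map (_∸ l) (map (_∸ j) (drop k (drop i xs))))
    ≡⟨ cong pos (map-∘ (drop k (drop i xs))) ⟨
  pos (map (λ x → x ∸ j ∸ l) (drop k (drop i xs)))
    ≡⟨ cong pos (map-cong (λ x → ∸-+-assoc x j l) (drop k (drop i xs))) ⟩
  pos (map (_∸ (j + l)) (drop k (drop i xs)))
    ≡⟨ cong (pos ∘ map (_∸ (j + l))) (drop-drop i k xs) ⟩
  pos (map (_∸ (j + l)) (drop (i + k) xs)) ∎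
  where
  open ≡-Reasoning
  pos : List ℕ → List ℕ
  pos = filter (0 <?_)
  pairs : ∀ {ys} → AllPairs _≥_ ys → AllPairs (λ x y → x ∸ j ≥ y ∸ j) ys
  pairs = AllPairs.map (∸-monoˡ-≤ j)

-- Identifies positions reached along different routes: μ [ 1 , 2 ] [ 1 , 0 ] and μ [ 2 , 1 ]
-- [ 0 , 1 ] are both μ [ 2 , 2 ].
[,]-[,] : ∀ μ i j k l → μ [ i , j ] [ k , l ] ≡ μ [ i + k , j + l ]
[,]-[,] μ i j k l = parts-injective
  (shift-shift i j k l (Linked.Linked⇒AllPairs (λ x≥y y≥z → ≤-trans y≥z x≥y) (decreasing μ)))

[,]-empty : ∀ μ i j → ¬ Nonempty μ → ¬ Nonempty (μ [ i , j ])
[,]-empty (partition [] _ _)      zero    _ _   ne = ne refl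
[,]-empty (partition [] _ _)      (suc i) _ _   ne = ne refl
[,]-empty (partition (_ ∷ _) _ _) _       _ ¬ne _  = ¬ne λ ()

-- States of positions and their recursion.

State : Set
State = Maybe (ℕ × ℕ)

values : Partition → ℕ × ℕ
values μ = spragueGrundy Knight μ , misère Knight μ

state : Partition → State
state μ with nonempty? μ
... | yes _ = just (values μ)
... | no  _ = nothing

-- The mex recursion for both values at once. An empty option is not a move, so `nothing` is
-- discarded, and two of them give the terminal pair (0 , 1).
next : State → State → ℕ × ℕ
next x y = combine 0 (map proj₁ vs) , combine 1 (map proj₂ vs)
  where
  vs : List (ℕ × ℕ)
  vs = catMaybes (x ∷ y ∷ [])

state-nonempty : ∀ {μ} → Nonempty μ → state μ ≡ just (values μ)
state-nonempty {μ} ne with nonempty? μ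
... | yes _  = refl
... | no ¬ne = contradiction ne ¬ne

state-empty : ∀ {μ} → ¬ Nonempty μ → state μ ≡ nothing
state-empty {μ} ¬ne with nonempty? μ
... | yes ne = contradiction ne ¬ne
... | no _   = refl

state-just⁻ : ∀ μ {v} → state μ ≡ just v → Nonempty μ × values μ ≡ v
state-just⁻ μ eq with nonempty? μ
... | yes ne = ne , just-injective eq
... | no _ with () ← eq

catMaybes-state : ∀ μs → catMaybes (map state μs) ≡ map values (filter nonempty? μs)
catMaybes-state []       = refl
catMaybes-state (μ ∷ μs) with nonempty? μ
... | yes _ = cong (values μ ∷_) (catMaybes-state μs)
... | no  _ = catMaybes-state μs

values-next : ∀ μ → values μ ≡ next (state (μ [ 1 , 2 ])) (state (μ [ 2 , 1 ]))
-- Which projection of `values` agrees with `value t` depends on `t`; for 0 and 1 the agreement is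
-- definitional.
values-next μ = cong₂ _,_ (unfold 0 proj₁ λ _ → refl) (unfold 1 proj₂ λ _ → refl)
  where
  νs : List Partition
  νs = μ [ 1 , 2 ] ∷ μ [ 2 , 1 ] ∷ []
  unfold : ∀ t (proj : ℕ × ℕ → ℕ) → (∀ ν → value t Knight ν ≡ proj (values ν)) →
           value t Knight μ ≡ combine t (map proj (catMaybes (map state νs)))
  unfold t proj eq = trans (value-unfold t Knight μ) (cong (combine t) (begin
    map (value t Knight) (options Knight μ)     ≡⟨ map-cong eq (options Knight μ) ⟩
    map (proj ∘ values) (options Knight μ)      ≡⟨ map-∘ (options Knight μ) ⟩
    map proj (map values (options Knight μ))    ≡⟨ cong (map proj) (catMaybes-state νs) ⟨
    map proj (catMaybes (map state νs))         ∎))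
    where
    open ≡-Reasoning

state-next : ∀ μ → Nonempty μ → state μ ≡ just (next (state (μ [ 1 , 2 ])) (state (μ [ 2 , 1 ])))
state-next μ ne = trans (state-nonempty ne) (cong just (values-next μ))

-- The pairs (x , y) for x in the left column and y in its row: the closure of the
-- first row and its mirror image under
-- (x , y) , (y , z) ↦ (just (next x y) , just (next y z)).
adjacentStates : List (State × State)
adjacentStates = concatMap (λ (x , ys) → map (x ,_) ys)
  ( (nothing , nothing ∷ ● 0 1 ∷ [])
  ∷ (● 0 1   , nothing ∷ ● 0 0 ∷ ● 0 1 ∷ ● 1 0 ∷ ● 2 1 ∷ ● 2 2 ∷ [])
  ∷ (● 1 0   , ● 0 0 ∷ ● 0 1 ∷ ● 1 0 ∷ ● 1 2 ∷ ● 2 2 ∷ [])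
  ∷ (● 0 0   , ● 0 0 ∷ ● 0 1 ∷ ● 1 0 ∷ [])
  ∷ (● 1 1   , ● 1 1 ∷ ● 1 2 ∷ ● 2 1 ∷ [])
  ∷ (● 1 2   , ● 1 0 ∷ ● 1 1 ∷ ● 1 2 ∷ ● 2 1 ∷ ● 2 2 ∷ [])
  ∷ (● 2 1   , ● 0 1 ∷ ● 1 1 ∷ ● 1 2 ∷ ● 2 1 ∷ ● 2 2 ∷ [])
  ∷ (● 2 2   , ● 0 1 ∷ ● 1 0 ∷ ● 1 2 ∷ ● 2 1 ∷ ● 2 2 ∷ [])
  ∷ [])
  where
  ● : ℕ → ℕ → State
  ● t ℓ = just (t , ℓ)

infix 4 _∼_

_∼_ : State → State → Set
x ∼ y = (x , y) ∈ adjacentStates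

_≟ᵛ_ : DecidableEquality (ℕ × ℕ)
_≟ᵛ_ = Product.≡-dec _≟_ _≟_

_≟ˢ_ : DecidableEquality State
_≟ˢ_ = Maybe.≡-dec _≟ᵛ_

_≟ᵖ_ : DecidableEquality (State × State)
_≟ᵖ_ = Product.≡-dec _≟ˢ_ _≟ˢ_

open import Data.List.Membership.DecPropositional _≟ˢ_ using () renaming (_∈?_ to _∈ˢ?_)
open import Data.List.Membership.DecPropositional _≟ᵖ_ using () renaming (_∈?_ to _∈ᵖ?_)

-- Decided by evaluation over all pairs of entries. The shared middle state becomes the decidable
-- premise `y ≡ y′`, because the two entries are enumerated independently.
∼-next : ∀ {x y z} → x ∼ y → y ∼ z → just (next x y) ∼ just (next y z)
∼-next x∼y y∼z = All.lookup (All.lookup check x∼y) y∼z refl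
  where
  check : All (λ (x , y) → All (λ (y′ , z) → y ≡ y′ →
            just (next x y) ∼ just (next y′ z)) adjacentStates) adjacentStates
  check = from-yes (All.all? (λ (x , y) → All.all? (λ (y′ , z) → (y ≟ˢ y′) →-dec
            ((just (next x y) , just (next y′ z)) ∈ᵖ? adjacentStates)) adjacentStates) adjacentStates)

-- The bounds by 2 replace the quantifier over all k ≥ 2 and so make the condition decidable.
∼-domestic : ∀ {x y} → x ∼ y → let (t , ℓ) = next x y in (t ≡ 0 → ℓ < 2) × (ℓ ≡ 0 → t < 2)
∼-domestic x∼y = All.lookup check x∼y
  where
  check : All (λ (x , y) → let (t , ℓ) = next x y in (t ≡ 0 → ℓ < 2) × (ℓ ≡ 0 → t < 2)) adjacentStates
  check = from-yes (All.all? (λ (x , y) → let (t , ℓ) = next x y in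
            ((t ≟ 0) →-dec (ℓ <? 2)) ×-dec ((ℓ ≟ 0) →-dec (t <? 2))) adjacentStates)

-- Here x and y are the option states of a position with values v, and a and b those of the position
-- moved to; two empty options would make the latter terminal. Every adjacent pair (a , b) that
-- yields the state x or y is tested, whatever its overlap with the first position.
Returning : ℕ × ℕ → Set
Returning v = All (λ (x , y) → next x y ≡ v →
  All (λ (a , b) → just (next a b) ∈ x ∷ y ∷ [] → (a , b) ≢ (nothing , nothing) →
    just v ∈ a ∷ b ∷ []) adjacentStates) adjacentStates

returning? : ∀ v → Dec (Returning v)
returning? v = All.all? (λ (x , y) → (next x y ≟ᵛ v) →-dec
  All.all? (λ (a , b) → (just (next a b) ∈ˢ? x ∷ y ∷ []) →-dec ¬? ((a , b) ≟ᵖ (nothing , nothing)) →-dec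
    (just v ∈ˢ? a ∷ b ∷ [])) adjacentStates) adjacentStates

-- Induction on size.

adjacentAcc : ∀ μ → Acc _<_ (size μ) → state (μ [ 0 , 1 ]) ∼ state (μ [ 1 , 0 ])
adjacentAcc μ (acc rs) = by-cases (nonempty? u) (nonempty? v)
  where
  u v : Partition
  u = μ [ 0 , 1 ]
  v = μ [ 1 , 0 ]

  descend : ∀ {ν} → ν ∈ μ [ 1 , 2 ] ∷ μ [ 2 , 1 ] ∷ [] → state (ν [ 0 , 1 ]) ∼ state (ν [ 1 , 0 ])
  descend {ν} ν∈ with nonempty? ν
  ... | yes ne = adjacentAcc ν (rs (options-< Knight μ (∈-filter⁺ nonempty? ν∈ ne)))
  -- An empty ν is not an option, so `options-<` does not apply; its neighbours are empty too, and
  -- (nothing , nothing) is the first entry of the set.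
  ... | no ¬ne = subst₂ _∼_ (sym (state-empty ([,]-empty ν 0 1 ¬ne))) (sym (state-empty ([,]-empty ν 1 0 ¬ne)))
                   (here refl)

  below : ∀ i j k l → ¬ Nonempty (μ [ i , j ]) → state (μ [ i + k , j + l ]) ≡ nothing
  below i j k l ¬ne = trans (cong state (sym ([,]-[,] μ i j k l))) (state-empty ([,]-empty (μ [ i , j ]) k l ¬ne))

  [1,3]∼[2,2] : state (μ [ 1 , 3 ]) ∼ state (μ [ 2 , 2 ])
  [1,3]∼[2,2] = subst₂ (λ ν ν′ → state ν ∼ state ν′)
    ([,]-[,] μ 1 2 0 1) ([,]-[,] μ 1 2 1 0) (descend (here refl))

  [2,2]∼[3,1] : state (μ [ 2 , 2 ]) ∼ state (μ [ 3 , 1 ])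
  [2,2]∼[3,1] = subst₂ (λ ν ν′ → state ν ∼ state ν′)
    ([,]-[,] μ 2 1 0 1) ([,]-[,] μ 2 1 1 0) (descend (there (here refl)))

  state-u : Nonempty u → state u ≡ just (next (state (μ [ 1 , 3 ])) (state (μ [ 2 , 2 ])))
  state-u ne = trans (state-next u ne)
    (cong₂ (λ ν ν′ → just (next (state ν) (state ν′))) ([,]-[,] μ 0 1 1 2) ([,]-[,] μ 0 1 2 1))

  state-v : Nonempty v → state v ≡ just (next (state (μ [ 2 , 2 ])) (state (μ [ 3 , 1 ])))
  state-v ne = trans (state-next v ne)
    (cong₂ (λ ν ν′ → just (next (state ν) (state ν′))) ([,]-[,] μ 1 0 1 2) ([,]-[,] μ 1 0 2 1))

  by-cases : Dec (Nonempty u) → Dec (Nonempty v) → state u ∼ state v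
  by-cases (yes u≢[]) (yes v≢[]) = subst₂ _∼_ (sym (state-u u≢[])) (sym (state-v v≢[]))
    (∼-next [1,3]∼[2,2] [2,2]∼[3,1])
  -- Here μ is a single part. Both options of u, [ 1 , 3 ] and [ 2 , 2 ], lie beyond v = μ
  -- [ 1 , 0 ], so u is terminal.
  by-cases (yes u≢[]) (no v≡[]) = subst₂ _∼_
    (sym (trans (state-u u≢[]) (cong₂ (λ x y → just (next x y)) (below 1 0 0 3 v≡[]) (below 1 0 1 2 v≡[]))))
    (sym (state-empty v≡[])) (from-yes ((just (0 , 1) , nothing) ∈ᵖ? adjacentStates))
  -- Here all parts of μ are 1. Both options of v, [ 2 , 2 ] and [ 3 , 1 ], lie beyond u = μ
  -- [ 0 , 1 ], so v is terminal.
  by-cases (no u≡[]) (yes v≢[]) = subst₂ _∼_ (sym (state-empty u≡[]))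
    (sym (trans (state-v v≢[]) (cong₂ (λ x y → just (next x y)) (below 0 1 2 1 u≡[]) (below 0 1 3 0 u≡[]))))
    (from-yes ((nothing , just (0 , 1)) ∈ᵖ? adjacentStates))
  by-cases (no u≡[]) (no v≡[]) = subst₂ _∼_ (sym (state-empty u≡[])) (sym (state-empty v≡[])) (here refl)

options-adjacent : ∀ μ → state (μ [ 1 , 2 ]) ∼ state (μ [ 2 , 1 ])
options-adjacent μ = subst₂ (λ ν ν′ → state ν ∼ state ν′) ([,]-[,] μ 1 1 0 1) ([,]-[,] μ 1 1 1 0)
  (adjacentAcc (μ [ 1 , 1 ]) (<-wellFounded _))

-- Domesticity and returnability.

knight-domestic : ∀ λ₀ → Domestic Knight λ₀
knight-domestic _ {x} _ k 2≤k =
  (λ (t≡0 , ℓ≡k) → <⇒≱ (proj₁ bounds t≡0) (subst (2 ≤_) (sym ℓ≡k) 2≤k)) ,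
  (λ (t≡k , ℓ≡0) → <⇒≱ (proj₂ bounds ℓ≡0) (subst (2 ≤_) (sym t≡k) 2≤k))
  where
  bounds : (spragueGrundy Knight x ≡ 0 → misère Knight x < 2) × (misère Knight x ≡ 0 → spragueGrundy Knight x < 2)
  bounds = subst (λ (t , ℓ) → (t ≡ 0 → ℓ < 2) × (ℓ ≡ 0 → t < 2)) (sym (values-next x))
    (∼-domestic (options-adjacent x))

∈-options⁻ : ∀ x {y} → y ∈ options Knight x →
  Nonempty y × state y ∈ state (x [ 1 , 2 ]) ∷ state (x [ 2 , 1 ]) ∷ []
∈-options⁻ x y∈ with ∈-filter⁻ nonempty? {xs = x [ 1 , 2 ] ∷ x [ 2 , 1 ] ∷ []} y∈
... | y∈′ , ne = ne , ∈-map⁺ state y∈′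

terminal : ∀ y → (state (y [ 1 , 2 ]) , state (y [ 2 , 1 ])) ≡ (nothing , nothing) → Terminal Knight y
terminal y eq z z∈ with ∈-options⁻ y z∈
... | ne , s∈ with subst (λ (a , b) → state z ∈ a ∷ b ∷ []) eq s∈
... | here s≡         = contradiction (trans (sym (state-nonempty ne)) s≡) λ ()
... | there (here s≡) = contradiction (trans (sym (state-nonempty ne)) s≡) λ ()

return : ∀ {v} → Returning v → ∀ x y → y ∈ options Knight x → ¬ Terminal Knight y → values x ≡ v →
         ∃ λ z → z ∈ options Knight y × values z ≡ v
return ret x y y∈ ¬term x≡v with ∈-options⁻ x y∈
-- The outer check is read at the option pair of x and the inner one at that of y. The resulting
-- membership of `just v` is then lifted along `state` to an actual option z.
... | ne , s∈ with ∈-map⁻ state {xs = y [ 1 , 2 ] ∷ y [ 2 , 1 ] ∷ []}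
                     (All.lookup (All.lookup ret (options-adjacent x) (trans (sym (values-next x)) x≡v))
                        (options-adjacent y) (subst (_∈ state (x [ 1 , 2 ]) ∷ state (x [ 2 , 1 ]) ∷ []) (state-next y ne) s∈)
                        (¬term ∘ terminal y))
... | z , z∈ , v≡ with state-just⁻ z (sym v≡)
... | z-ne , z≡v = z , ∈-filter⁺ nonempty? z∈ z-ne , z≡v

knight-returnable : ∀ λ₀ → Returnable Knight λ₀
knight-returnable _ {x} {y} _ x⟶y ¬term =
  returns (from-yes (returning? (0 , 1))) , returns (from-yes (returning? (1 , 0)))
  where
  returns : ∀ {t ℓ} → Returning (t , ℓ) → spragueGrundy Knight x ≡ t × misère Knight x ≡ ℓ →
            ∃ λ z → z ∈ options Knight y × spragueGrundy Knight z ≡ t × misère Knight z ≡ ℓ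
  returns ret (t≡ , ℓ≡) with return ret x y x⟶y ¬term (cong₂ _,_ t≡ ℓ≡)
  ... | z , z∈ , z≡ = z , z∈ , Product.,-injective z≡

-- Failure of tameness and forcedness.

-- [15³, 10³, 5³], a (2,1)-position
untame : Partition
untame = staircase 3 5 3 (s≤s z≤n) [ 0 , 0 ]

untame-not-tame : ¬ Tame Knight untame
untame-not-tame tame with tame ε
... | inj₁ (() , _)
... | inj₂ (inj₁ (() , _))
... | inj₂ (inj₂ (_ , t≡k , ℓ≡k)) = contradiction (trans t≡k (sym ℓ≡k)) λ ()

-- [7⁴], a (0,1)-position with an option of Sprague-Grundy value 2
unforced : Partition
unforced = staircase 4 7 1 (s≤s z≤n) [ 0 , 0 ]

unforced-not-forced : ¬ Forced Knight unforced
-- `here refl` is the move by (1 , 2) to [5³]. Its options [3²] and [4] have values (1 , 0) and (0 ,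
-- 1), so it is a (2 , 2)-position.
unforced-not-forced forced with proj₁ (forced ε (here refl)) (refl , refl)
... | () , _

theorem4p14 : (Has Domestic Knight (NonemptySubpartitionOf GeneralizedStaircase)
    × Lacks Tame Knight (NonemptySubpartitionOf GeneralizedStaircase)
    × Has Returnable Knight (NonemptySubpartitionOf GeneralizedStaircase)
    × Lacks Forced Knight (NonemptySubpartitionOf GeneralizedStaircase))
    × (Has Domestic Knight Nonempty
    × Lacks Tame Knight Nonempty
    × Has Returnable Knight Nonempty
    × Lacks Forced Knight Nonempty)
theorem4p14 =
  ( (λ μ _ → knight-domestic μ)
  -- Since `untame` is defined as a shift by (0 , 0), `refl` shows it to be a subpartition.
  , (untame , (_ , gs {3} {5} {3} (s≤s z≤n) (s≤s z≤n) (s≤s z≤n) , 0 , 0 , refl , λ ()) , untame-not-tame)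
  , (λ μ _ → knight-returnable μ)
  , (unforced , (_ , gs {4} {7} {1} (s≤s z≤n) (s≤s z≤n) (s≤s z≤n) , 0 , 0 , refl , λ ()) , unforced-not-forced) )
  , (λ μ _ → knight-domestic μ)
  , (untame , (λ ()) , untame-not-tame)
  , (λ μ _ → knight-returnable μ)
  , (unforced , (λ ()) , unforced-not-forced)
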